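{- There exists an $(\mathbb{F}_{p}\times \mathbb{F}_{q},\mathbb{F}_{p}\times \{0\},p,(p-1)/4)$-DF for all prime powers $p$ and $q$ with $p\equiv q\equiv 1 \pmod{4}$ and $q\geq p$.
   Context: For an additive group $G$ with a subgroup $N$, a $(G,N,k,\lambda)$ relative difference family (DF) is a multiset $[B_1,\dots,B_r]$ of $k$-subsets of $G$ such that the multiset $\bigcup_{i}[x-y: x,y\in B_i, x\neq y]$ contains every element of $G\setminus N$ exactly $\lambda$ times and no element of $N$. -}

module Defs where

open import Level using (0ℓ)
open import Data.Nat using (ℕ; _≥_; _^_)
open import Data.Nat.Primality using (Prime)
open import Data.Fin using (Fin)
import Data.Fin.Properties as FinP
open import Data.Vec using (Vec; lookup)
open import Data.List using (List; []; _∷_; [_]; concatMap; allFin; filter; length)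
open import Data.List.Relation.Unary.All using (All)
open import Data.Product using (_×_; _,_; proj₁; proj₂; ∃; ∃-syntax)
open import Data.Bool using (if_then_else_)
open import Algebra.Core using (Op₁; Op₂)
open import Algebra.Structures using (IsCommutativeRing)
open import Function.Bundles using (_↔_; Inverse)
open import Function.Definitions using (Injective)
open import Relation.Binary.Definitions using (DecidableEquality)
open import Relation.Binary.PropositionalEquality using (_≡_; _≢_; refl; sym; trans; cong)
open import Relation.Nullary using (¬_; yes; no; does)

IsPrimePower : ℕ → Set
IsPrimePower p = ∃[ r ] ∃[ e ] (Prime r × e ≥ 1 × p ≡ r ^ e)

record FiniteField (n : ℕ) : Set₁ where
  field
    Carrier : Set
    _+_ _*_ : Op₂ Carrier
    -_ : Op₁ Carrier
    0# 1# : Carrier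
    isCommutativeRing : IsCommutativeRing _≡_ _+_ _*_ -_ 0# 1#
    0≢1 : 0# ≢ 1#
    inverse : ∀ x → x ≢ 0# → ∃[ y ] (x * y ≡ 1#)
    enumeration : Fin n ↔ Carrier

  _-_ : Op₂ Carrier
  x - y = x + (- y)

  _≟_ : DecidableEquality Carrier
  x ≟ y with FinP._≟_ (Inverse.from enumeration x) (Inverse.from enumeration y)
  ... | yes e = yes (trans (sym (Inverse.strictlyInverseˡ enumeration x))
                     (trans (cong (Inverse.to enumeration) e) (Inverse.strictlyInverseˡ enumeration y)))
  ... | no ne = no (λ e → ne (cong (Inverse.from enumeration) e))

-- Generic relative difference family over an additive group G (given by its
-- subtraction and decidable equality) relative to a subgroup N (a predicate).
module RelativeDF {G : Set} (_≟_ : DecidableEquality G) (_-_ : Op₂ G) (N : G → Set) where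

  IsKSubset : ∀ {k} → Vec G k → Set
  IsKSubset v = Injective _≡_ _≡_ (lookup v)

  differences : ∀ {k} → Vec G k → List G
  differences {k} v =
    concatMap (λ i → concatMap (λ j → if does (FinP._≟_ i j) then [] else [ lookup v i - lookup v j ])
                                (allFin k))
              (allFin k)

  allDifferences : ∀ {k} → List (Vec G k) → List G
  allDifferences = concatMap differences

  multiplicity : G → List G → ℕ
  multiplicity g xs = length (filter (g ≟_) xs)

  IsRelativeDF : (k lam : ℕ) → List (Vec G k) → Set
  IsRelativeDF k lam Bs =
    All IsKSubset Bs ×
    (∀ g → (N g → multiplicity g (allDifferences Bs) ≡ 0) ×
           (¬ N g → multiplicity g (allDifferences Bs) ≡ lam))

module _ {p q : ℕ} (F : FiniteField p) (K : FiniteField q) where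
  private
    module F = FiniteField F
    module K = FiniteField K

  ProdCarrier : Set
  ProdCarrier = F.Carrier × K.Carrier

  _≟×_ : DecidableEquality ProdCarrier
  (a , b) ≟× (c , d) with a F.≟ c | b K.≟ d
  ... | yes refl | yes refl = yes refl
  ... | no ne | _ = no (λ e → ne (cong proj₁ e))
  ... | yes _ | no ne = no (λ e → ne (cong proj₂ e))

  _-×_ : Op₂ ProdCarrier
  (a , b) -× (c , d) = (a F.- c , b K.- d)

  InFx0 : ProdCarrier → Set
  InFx0 g = proj₂ g ≡ K.0#

  ExistsRelDF : (k lam : ℕ) → Set
  ExistsRelDF k lam = ∃[ Bs ] RelativeDF.IsRelativeDF _≟×_ _-×_ InFx0 k lam Bs

{-# OPTIONS --safe #-}
module Submission where

-- Fix square roots j and i of -1 in F and K. As p ≤ q, there is an injection y : F → K with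
-- y(0) = 0 and y(jx) = i y(x). For s in a transversal S of ⟨i⟩ in K* take the block
-- { (x², s y(x)) : x ∈ F }. Replacing a pair (x, x') by (jx', jx) fixes x² - x'² and multiplies
-- y(x) - y(x') by -i, so a difference (d, l) occurs over S a quarter as often as over all scalars
-- s ∈ K*. If l ≠ 0, each pair x ≠ x' with x² - x'² = d realises (d, l) for exactly one scalar in
-- K*, and there are p - 1 such pairs, one for each u = x - x' ≠ 0.

open import Defs
open import Level using (Level; 0ℓ)
open import Algebra.Bundles using (CommutativeRing)
import Algebra.Properties.Ring as RingProperties
open import Algebra.Core using (Op₂)
open import Algebra.Structures using (IsCommutativeRing)
open import Data.Bool using (if_then_else_; true; false)
open import Data.Fin as Fin using (Fin)
import Data.Fin.Properties as Fin
open import Data.List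
  using (List; []; _∷_; [_]; _++_; map; concatMap; filter; length; allFin; tabulate; take; drop; zip)
open import Data.List.Membership.Propositional using (_∈_; _∉_; lose; find)
import Data.List.Membership.DecPropositional as DecMembership
open import Data.List.Membership.Propositional.Properties
  using (∈-++⁺ˡ; ∈-++⁺ʳ; ∈-++⁻; ∈-filter⁺; ∈-filter⁻; ∈-map⁺; ∈-allFin)
open import Data.List.Membership.Propositional.Properties.WithK using (unique∧set⇒bag)
open import Data.List.Properties
  using (map-++; map-∘; map-tabulate; map-concatMap; concatMap-map; concatMap-cong; concatMap-++;
         length-map; length-tabulate; length-++; filter-notAll; take++drop≡id)
open import Data.List.Relation.Binary.BagAndSetEquality using (∼bag⇒↭)
open import Data.List.Relation.Binary.Permutation.Propositional
  using (_↭_; ↭-refl; ↭-sym; ↭-trans; ↭-reflexive; prep; ↭⇒↭ₛ)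
import Data.List.Relation.Binary.Permutation.Propositional.Properties as Perm
import Data.List.Relation.Binary.Permutation.Setoid.Properties as PermSetoid
open import Data.List.Relation.Unary.All as All using (All; []; _∷_)
import Data.List.Relation.Unary.All.Properties as All
open import Data.List.Relation.Unary.AllPairs using ([]; _∷_)
open import Data.List.Relation.Unary.Any using (here; there; any?)
open import Data.List.Relation.Unary.Unique.Propositional using (Unique)
import Data.List.Relation.Unary.Unique.Propositional.Properties as Unique
open import Data.Nat using (ℕ; suc; _≤_; s≤s; _∸_; _/_; _%_)
open import Data.Nat.DivMod using ([m+kn]%n≡m%n; m≡m%n+[m/n]*n; m*n/n≡m)
open import Data.Nat.ListAction using (sum)
open import Data.Nat.ListAction.Properties using (sum-++; sum-↭)
import Data.Nat as Nat
import Data.Nat.Properties as ℕ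
open import Algebra.Properties.CommutativeSemigroup ℕ.+-commutativeSemigroup using (interchange)
open import Data.Product as Product using (_×_; _,_; proj₁; proj₂; ∃; ∃-syntax)
open import Data.Sum using (_⊎_; inj₁; inj₂; [_,_]′)
open import Data.Vec as Vec using (Vec; lookup; toList)
import Data.Vec.Properties as Vec
open import Function using (_∘_; id; mk⇔)
open import Function.Bundles using (Inverse; Injection)
open import Function.Definitions using (Injective)
open import Function.Properties.Inverse using (↔⇒↣)
open import Relation.Binary.Definitions using (DecidableEquality)
open import Relation.Binary.PropositionalEquality
  using (_≡_; _≢_; refl; sym; trans; cong; cong₂; subst; subst₂; setoid; module ≡-Reasoning)
open import Relation.Nullary using (¬_; Dec; yes; no; does; ¬?; contradiction)

-- The multiples of one block by all scalars in K* would give each wanted difference p - 1 times, so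
-- the burden lies in the factor 4: a symmetry of order four must act compatibly on both
-- coordinates. Squaring the first coordinate serves this purpose, since it turns multiplication by
-- j into a sign, and exchanging two points produces the same sign. The map y exists because
-- multiplication by j, respectively i, cuts the nonzero elements into orbits of size exactly four:
-- (p - 1)/4 of them in F and (q - 1)/4 in K. Representatives are paired arbitrarily and the pairing
-- is extended equivariantly; y respects no further structure. The square roots themselves, and the
-- invertibility of 2, are extracted from the residue of the field size modulo 4 by cutting the
-- field into small orbits and counting. One greedy lemma, `transversal`, supplies these partitions
-- and S alike.

private
  variable
    a b c : Level
    A B C : Set a

-- Finite sums over lists

module _ where
  open Nat using (_+_; _*_)

  ∑ : (A → ℕ) → List A → ℕ
  ∑ f xs = sum (map f xs)

  ∑-cong : ∀ {f g : A → ℕ} xs → (∀ {x} → x ∈ xs → f x ≡ g x) → ∑ f xs ≡ ∑ g xs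
  ∑-cong []       f≗g = refl
  ∑-cong (x ∷ xs) f≗g = cong₂ _+_ (f≗g (here refl)) (∑-cong xs (f≗g ∘ there))

  ∑-↭ : ∀ (f : A → ℕ) {xs ys} → xs ↭ ys → ∑ f xs ≡ ∑ f ys
  ∑-↭ f xs↭ys = sum-↭ (Perm.map⁺ f xs↭ys)

  ∑-map : ∀ (f : B → ℕ) (g : A → B) xs → ∑ f (map g xs) ≡ ∑ (f ∘ g) xs
  ∑-map f g xs = cong sum (sym (map-∘ xs))

  ∑-++ : ∀ (f : A → ℕ) xs ys → ∑ f (xs ++ ys) ≡ ∑ f xs + ∑ f ys
  ∑-++ f xs ys = trans (cong sum (map-++ f xs ys)) (sum-++ (map f xs) (map f ys))

  ∑-concatMap : ∀ (f : B → ℕ) (g : A → List B) xs → ∑ f (concatMap g xs) ≡ ∑ (λ x → ∑ f (g x)) xs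
  ∑-concatMap f g []       = refl
  ∑-concatMap f g (x ∷ xs) = trans (∑-++ f (g x) _) (cong (∑ f (g x) +_) (∑-concatMap f g xs))

  ∑-const : ∀ m (xs : List A) → ∑ (λ _ → m) xs ≡ length xs * m
  ∑-const m []       = refl
  ∑-const m (x ∷ xs) = cong (m +_) (∑-const m xs)

  ∑-zero : ∀ {f : A → ℕ} xs → (∀ {x} → x ∈ xs → f x ≡ 0) → ∑ f xs ≡ 0
  ∑-zero xs f≗0 = trans (∑-cong xs f≗0) (trans (∑-const 0 xs) (ℕ.*-zeroʳ (length xs)))

  ∑-distrib-+ : ∀ (f g : A → ℕ) xs → ∑ (λ x → f x + g x) xs ≡ ∑ f xs + ∑ g xs
  ∑-distrib-+ f g []       = refl
  ∑-distrib-+ f g (x ∷ xs) =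
    trans (cong (f x + g x +_) (∑-distrib-+ f g xs)) (interchange (f x) (g x) _ _)

  ∑-distribˡ-* : ∀ m (f : A → ℕ) xs → ∑ (λ x → m * f x) xs ≡ m * ∑ f xs
  ∑-distribˡ-* m f []       = sym (ℕ.*-zeroʳ m)
  ∑-distribˡ-* m f (x ∷ xs) =
    trans (cong (m * f x +_) (∑-distribˡ-* m f xs)) (sym (ℕ.*-distribˡ-+ m (f x) _))

  ∑-comm : ∀ (f : A → B → ℕ) xs ys → ∑ (λ x → ∑ (f x) ys) xs ≡ ∑ (λ y → ∑ (λ x → f x y) xs) ys
  ∑-comm f []       ys = sym (∑-zero ys (λ _ → refl))
  ∑-comm f (x ∷ xs) ys =
    trans (cong (∑ (f x) ys +_) (∑-comm f xs ys)) (sym (∑-distrib-+ (f x) _ ys))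

  𝟙 : {P : Set a} → Dec P → ℕ
  𝟙 P? = if does P? then 1 else 0

  module _ {P : Set a} {Q : Set b} where

    𝟙-cong : (P? : Dec P) (Q? : Dec Q) → (P → Q) → (Q → P) → 𝟙 P? ≡ 𝟙 Q?
    𝟙-cong (yes p) (yes q) to from = refl
    𝟙-cong (yes p) (no ¬q) to from = contradiction (to p) ¬q
    𝟙-cong (no ¬p) (yes q) to from = contradiction (from q) ¬p
    𝟙-cong (no ¬p) (no ¬q) to from = refl

    -- `R` carries its own decision, so that the equality test `_≟×_` on pairs can be split into two
    -- coordinate tests whatever way it computes.
    𝟙-× : {R : Set c} (P? : Dec P) (Q? : Dec Q) (R? : Dec R) →
          (R → P × Q) → (P → Q → R) → 𝟙 R? ≡ 𝟙 P? * 𝟙 Q?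
    𝟙-× (yes p) (yes q) (yes r) to from = refl
    𝟙-× (yes p) (yes q) (no ¬r) to from = contradiction (from p q) ¬r
    𝟙-× (yes p) (no ¬q) (yes r) to from = contradiction (proj₂ (to r)) ¬q
    𝟙-× (yes p) (no ¬q) (no ¬r) to from = refl
    𝟙-× (no ¬p) _       (yes r) to from = contradiction (proj₁ (to r)) ¬p
    𝟙-× (no ¬p) _       (no ¬r) to from = refl

  𝟙-yes : {P : Set a} (P? : Dec P) → P → 𝟙 P? ≡ 1
  𝟙-yes (yes _) p = refl
  𝟙-yes (no ¬p) p = contradiction p ¬p

  𝟙-no : {P : Set a} (P? : Dec P) → ¬ P → 𝟙 P? ≡ 0
  𝟙-no (yes p) ¬p = contradiction p ¬p
  𝟙-no (no _)  ¬p = refl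

  𝟙-yes-* : {P : Set a} (P? : Dec P) → P → ∀ m → 𝟙 P? * m ≡ m
  𝟙-yes-* P? p m = trans (cong (_* m) (𝟙-yes P? p)) (ℕ.*-identityˡ m)

  𝟙-no-* : {P : Set a} (P? : Dec P) → ¬ P → ∀ m → 𝟙 P? * m ≡ 0
  𝟙-no-* P? ¬p m = cong (_* m) (𝟙-no P? ¬p)

  length-filter≡∑ : {P : A → Set b} (P? : ∀ x → Dec (P x)) (xs : List A) →
                    length (filter P? xs) ≡ ∑ (λ x → 𝟙 (P? x)) xs
  length-filter≡∑ P? []       = refl
  length-filter≡∑ P? (x ∷ xs) with does (P? x)
  ... | true  = cong suc (length-filter≡∑ P? xs)
  ... | false = length-filter≡∑ P? xs

  ∑-𝟙-∃! : {P : A → Set b} (P? : ∀ x → Dec (P x)) {xs : List A} {x : A} →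
           Unique xs → x ∈ xs → P x → (∀ {y} → P y → y ≡ x) → ∑ (λ y → 𝟙 (P? y)) xs ≡ 1
  ∑-𝟙-∃! P? {y ∷ ys} {.y} (y∉ys ∷ _) (here refl) px uniq =
    cong₂ _+_ (𝟙-yes (P? y) px)
      (∑-zero ys λ {z} z∈ys → 𝟙-no (P? z) λ pz → All.lookup y∉ys z∈ys (sym (uniq pz)))
  ∑-𝟙-∃! P? {y ∷ ys} {x} (y∉ys ∷ ys!) (there x∈ys) px uniq =
    cong₂ _+_ (𝟙-no (P? y) λ py → All.lookup y∉ys x∈ys (uniq py)) (∑-𝟙-∃! P? ys! x∈ys px uniq)

-- Duplicate-free lists and orbit decompositions

unique∧set⇒↭ : {xs ys : List A} → Unique xs → Unique ys →
               (∀ {x} → x ∈ xs → x ∈ ys) → (∀ {x} → x ∈ ys → x ∈ xs) → xs ↭ ys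
unique∧set⇒↭ xs! ys! xs⊆ys ys⊆xs = ∼bag⇒↭ (unique∧set⇒bag xs! ys! (mk⇔ xs⊆ys ys⊆xs))

Unique-resp-↭ : {xs ys : List A} → xs ↭ ys → Unique xs → Unique ys
Unique-resp-↭ xs↭ys = PermSetoid.Unique-resp-↭ (setoid _) (↭⇒↭ₛ xs↭ys)

Unique-++⁻ˡ : ∀ (xs : List A) {ys} → Unique (xs ++ ys) → Unique xs
Unique-++⁻ˡ []       _           = []
Unique-++⁻ˡ (x ∷ xs) (x∉ ∷ rest) = All.++⁻ˡ xs x∉ ∷ Unique-++⁻ˡ xs rest

Unique-map-injective : ∀ (f : A → B) {xs x y} → Unique (map f xs) →
                       x ∈ xs → y ∈ xs → f x ≡ f y → x ≡ y
Unique-map-injective f _          (here refl)  (here refl)  _  = refl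
Unique-map-injective f (fx∉ ∷ _)  (here refl)  (there y∈)   eq = contradiction eq (All.lookup fx∉ (∈-map⁺ f y∈))
Unique-map-injective f (fy∉ ∷ _)  (there x∈)   (here refl)  eq = contradiction (sym eq) (All.lookup fy∉ (∈-map⁺ f x∈))
Unique-map-injective f (_ ∷ rest) (there x∈)   (there y∈)   eq = Unique-map-injective f rest x∈ y∈ eq

length-concatMap : ∀ (f : A → List B) m → (∀ x → length (f x) ≡ m) →
                   ∀ xs → length (concatMap f xs) ≡ length xs Nat.* m
length-concatMap f m eq []       = refl
length-concatMap f m eq (x ∷ xs) =
  trans (length-++ (f x)) (cong₂ Nat._+_ (eq x) (length-concatMap f m eq xs))

module _ {A : Set a} (_≟_ : DecidableEquality A) where
  open DecMembership _≟_ using (_∈?_)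

  infixl 5 _∖_
  _∖_ : List A → List A → List A
  xs ∖ ys = filter (λ x → ¬? (x ∈? ys)) xs

  ↭-∖ : ∀ {xs ys} → Unique xs → Unique ys → (∀ {x} → x ∈ ys → x ∈ xs) → xs ↭ ys ++ (xs ∖ ys)
  ↭-∖ {xs} {ys} xs! ys! ys⊆xs = unique∧set⇒↭ xs!
    (Unique.++⁺ ys! (Unique.filter⁺ _ xs!) λ (p , q) → proj₂ (∈-filter⁻ (λ x → ¬? (x ∈? ys)) {xs = xs} q) p)
    to from
    where
    to : ∀ {x} → x ∈ xs → x ∈ ys ++ (xs ∖ ys)
    to {x} x∈xs with x ∈? ys
    ... | yes x∈ys = ∈-++⁺ˡ x∈ys
    ... | no  x∉ys = ∈-++⁺ʳ ys (∈-filter⁺ _ x∈xs x∉ys)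
    from : ∀ {x} → x ∈ ys ++ (xs ∖ ys) → x ∈ xs
    from x∈ = [ ys⊆xs , (λ q → proj₁ (∈-filter⁻ _ {xs = xs} q)) ]′ (∈-++⁻ ys x∈)

  module _ (orbit : A → List A)
           (orbit-refl  : ∀ x → x ∈ orbit x)
           (orbit-sym   : ∀ {x y} → y ∈ orbit x → x ∈ orbit y)
           (orbit-trans : ∀ {x y z} → y ∈ orbit x → z ∈ orbit y → z ∈ orbit x) where

    -- Greedy choice: the head becomes a representative and its whole orbit is removed. The
    -- remainder is still closed, because an element whose orbit meets `orbit x` lies in `orbit x`
    -- itself.
    transversal : ∀ xs → Unique xs → (∀ {x y} → x ∈ xs → y ∈ orbit x → y ∈ xs) →
                  (∀ {x} → x ∈ xs → Unique (orbit x)) → ∃[ reps ] concatMap orbit reps ↭ xs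
    transversal xs = go xs (length xs) ℕ.≤-refl
      where
      -- The bound `n` is the recursion measure: an orbit contains its own base point, so each
      -- removal shortens the list.
      go : ∀ xs n → length xs ≤ n → Unique xs → (∀ {x y} → x ∈ xs → y ∈ orbit x → y ∈ xs) →
           (∀ {x} → x ∈ xs → Unique (orbit x)) → ∃[ reps ] concatMap orbit reps ↭ xs
      go []           n       _  _   _      _      = [] , ↭-refl
      go xs@(x ∷ xs₀) (suc n) le xs! closed orbit! =
        x ∷ proj₁ rec ,
        ↭-trans (Perm.++⁺ˡ (orbit x) (proj₂ rec))
                (↭-sym (↭-∖ xs! (orbit! (here refl)) (closed (here refl))))
        where
        fresh? : ∀ y → Dec (y ∉ orbit x)
        fresh? y = ¬? (y ∈? orbit x)
        ∈⁻ : ∀ {y} → y ∈ xs ∖ orbit x → y ∈ xs × y ∉ orbit x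
        ∈⁻ = ∈-filter⁻ fresh? {xs = xs}
        rec = go (xs ∖ orbit x) n
          (ℕ.≤-pred (ℕ.≤-trans (filter-notAll fresh? xs (here (λ x∉ → x∉ (orbit-refl x)))) le))
          (Unique.filter⁺ fresh? xs!)
          (λ y∈ z∈ → ∈-filter⁺ fresh? (closed (proj₁ (∈⁻ y∈)) z∈)
                       λ z∈x → proj₂ (∈⁻ y∈) (orbit-trans z∈x (orbit-sym z∈)))
          (orbit! ∘ proj₁ ∘ ∈⁻)

-- Orbits of a map whose fourth power is the identity

orbit₄ : (A → A) → A → List A
orbit₄ f x = x ∷ f x ∷ f (f x) ∷ f (f (f x)) ∷ []

module _ (f : A → A) (f⁴≗id : ∀ x → f (f (f (f x))) ≡ x) where

  orbit₄-closed : ∀ {x y} → y ∈ orbit₄ f x → f y ∈ orbit₄ f x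
  orbit₄-closed (here refl)                         = there (here refl)
  orbit₄-closed (there (here refl))                 = there (there (here refl))
  orbit₄-closed (there (there (here refl)))         = there (there (there (here refl)))
  orbit₄-closed (there (there (there (here refl)))) = here (f⁴≗id _)

  orbit₄-trans : ∀ {x y z} → y ∈ orbit₄ f x → z ∈ orbit₄ f y → z ∈ orbit₄ f x
  orbit₄-trans y∈ (here refl)                         = y∈
  orbit₄-trans y∈ (there (here refl))                 = orbit₄-closed y∈
  orbit₄-trans y∈ (there (there (here refl)))         = orbit₄-closed (orbit₄-closed y∈)
  orbit₄-trans y∈ (there (there (there (here refl)))) = orbit₄-closed (orbit₄-closed (orbit₄-closed y∈))

  orbit₄-sym : ∀ {x y} → y ∈ orbit₄ f x → x ∈ orbit₄ f y
  orbit₄-sym (here refl)                         = here refl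
  orbit₄-sym (there (here refl))                 = there (there (there (here (sym (f⁴≗id _)))))
  orbit₄-sym (there (there (here refl)))         = there (there (here (sym (f⁴≗id _))))
  orbit₄-sym (there (there (there (here refl)))) = there (here (sym (f⁴≗id _)))

  -- Every nontrivial subgroup of a cyclic group of order 4 contains the square of the generator.
  -- Hence a point moved by the square has trivial stabiliser.
  orbit₄-unique : ∀ {x} → f (f x) ≢ x → Unique (orbit₄ f x)
  orbit₄-unique {x} ffx≢x =
    ((λ e → fx≢x (sym e)) ∷ (λ e → ffx≢x (sym e)) ∷ x≢fffx ∷ []) ∷
    ((λ e → fx≢x (sym (inj e))) ∷ (λ e → ffx≢x (sym (inj e))) ∷ []) ∷
    ((λ e → fx≢x (sym (inj (inj e)))) ∷ []) ∷
    [] ∷ []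
    where
    inj : ∀ {y z} → f y ≡ f z → y ≡ z
    inj e = trans (sym (f⁴≗id _)) (trans (cong (f ∘ f ∘ f) e) (f⁴≗id _))
    fx≢x : f x ≢ x
    fx≢x e = ffx≢x (trans (cong f e) e)
    x≢fffx : x ≢ f (f (f x))
    x≢fffx e = fx≢x (trans (cong f e) (f⁴≗id x))

  orbit₄-rotate : ∀ x → map f (orbit₄ f x) ↭ orbit₄ f x
  orbit₄-rotate x = subst (λ y → f x ∷ f (f x) ∷ f (f (f x)) ∷ y ∷ [] ↭ orbit₄ f x) (sym (f⁴≗id x))
    (Perm.shift x (f x ∷ f (f x) ∷ f (f (f x)) ∷ []) [])

  concatMap-orbit₄-rotate : ∀ xs → map f (concatMap (orbit₄ f) xs) ↭ concatMap (orbit₄ f) xs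
  concatMap-orbit₄-rotate []       = ↭-refl
  concatMap-orbit₄-rotate (x ∷ xs) = Perm.++⁺ (orbit₄-rotate x) (concatMap-orbit₄-rotate xs)

  transversal₄ : DecidableEquality A → ∀ {xs} → Unique xs → (∀ {x} → x ∈ xs → f x ∈ xs) →
                 (∀ {x} → x ∈ xs → f (f x) ≢ x) → ∃[ reps ] concatMap (orbit₄ f) reps ↭ xs
  transversal₄ _≟_ {xs} xs! closed free =
    transversal _≟_ (orbit₄ f) (λ _ → here refl) orbit₄-sym orbit₄-trans xs xs! closed′ (orbit₄-unique ∘ free)
    where
    closed′ : ∀ {x y} → x ∈ xs → y ∈ orbit₄ f x → y ∈ xs
    closed′ x∈ (here refl)                         = x∈
    closed′ x∈ (there (here refl))                 = closed x∈
    closed′ x∈ (there (there (here refl)))         = closed (closed x∈)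
    closed′ x∈ (there (there (there (here refl)))) = closed (closed (closed x∈))


-- Finite fields

module Field {n : ℕ} (F : FiniteField n) where

  open FiniteField F public
    renaming (_+_ to infixl 6 _+_; _*_ to infixl 7 _*_; _-_ to infixl 6 _-_; -_ to infix 8 -_)
  open IsCommutativeRing isCommutativeRing public
    using (+-assoc; +-comm; +-identityˡ; +-identityʳ; -‿inverseʳ;
           *-assoc; *-comm; *-identityˡ; *-identityʳ; distribˡ; zeroˡ; zeroʳ)
  open DecMembership _≟_ public using (_∈?_)

  commutativeRing : CommutativeRing 0ℓ 0ℓ
  commutativeRing = record { isCommutativeRing = isCommutativeRing }

  open RingProperties (CommutativeRing.ring commutativeRing) public

  open ≡-Reasoning

  2# : Carrier
  2# = 1# + 1#

  *-cancelˡ-nonZero : ∀ {x y z} → x ≢ 0# → x * y ≡ x * z → y ≡ z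
  *-cancelˡ-nonZero {x} {y} {z} x≢0 eq = trans (sym (cancel y)) (trans (cong (x⁻¹ *_) eq) (cancel z))
    where
    x⁻¹ = proj₁ (inverse x x≢0)
    cancel : ∀ w → x⁻¹ * (x * w) ≡ w
    cancel w = begin
      x⁻¹ * (x * w)  ≡⟨ *-assoc x⁻¹ x w ⟨
      x⁻¹ * x * w    ≡⟨ cong (_* w) (trans (*-comm x⁻¹ x) (proj₂ (inverse x x≢0))) ⟩
      1# * w         ≡⟨ *-identityˡ w ⟩
      w              ∎

  integral : ∀ {x y} → x ≢ 0# → y ≢ 0# → x * y ≢ 0#
  integral {x} x≢0 y≢0 eq = y≢0 (*-cancelˡ-nonZero x≢0 (trans eq (sym (zeroʳ x))))

  [-x]-[-y]≡y-x : ∀ x y → - x - - y ≡ y - x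
  [-x]-[-y]≡y-x x y = trans (cong (- x +_) (-‿involutive y)) (+-comm (- x) y)

  x²-y²≡[x-y][x+y] : ∀ x y → x * x - y * y ≡ (x - y) * (x + y)
  x²-y²≡[x-y][x+y] x y = sym (begin
    (x - y) * (x + y)                ≡⟨ distribˡ (x - y) x y ⟩
    (x - y) * x + (x - y) * y        ≡⟨ cong₂ _+_ ([y-z]x≈yx-zx x x y) ([y-z]x≈yx-zx y x y) ⟩
    x * x - y * x + (x * y - y * y)  ≡⟨ +-assoc (x * x - y * x) (x * y) _ ⟨
    x * x - y * x + x * y - y * y    ≡⟨ cong (_- y * y) (begin
      x * x - y * x + x * y            ≡⟨ cong (x * x - y * x +_) (*-comm x y) ⟩
      x * x - y * x + y * x            ≡⟨ //-rightDividesˡ (y * x) (x * x) ⟩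
      x * x                            ∎) ⟩
    x * x - y * y                    ∎)

  x²≡1⇒x≡1⊎x≡-1 : ∀ x → x * x ≡ 1# → x ≡ 1# ⊎ x ≡ - 1#
  x²≡1⇒x≡1⊎x≡-1 x eq with x ≟ 1# | x ≟ (- 1#)
  ... | yes x≡1 | _         = inj₁ x≡1
  ... | no  _   | yes x≡-1  = inj₂ x≡-1
  ... | no  x≢1 | no  x≢-1  = contradiction
    (begin
      (x - 1#) * (x + 1#)  ≡⟨ x²-y²≡[x-y][x+y] x 1# ⟨
      x * x - 1# * 1#      ≡⟨ cong₂ _-_ eq (*-identityˡ 1#) ⟩
      1# - 1#              ≡⟨ -‿inverseʳ 1# ⟩
      0#                   ∎)
    (integral (x≢1 ∘ x∙y⁻¹≈ε⇒x≈y _ _)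
      λ x+1≡0 → x≢-1 (x∙y⁻¹≈ε⇒x≈y _ _ (trans (cong (x +_) (-‿involutive 1#)) x+1≡0)))

  -- Total, with the junk value 0# ⁻¹ ≡ 0#.
  infix 9 _⁻¹
  _⁻¹ : Carrier → Carrier
  x ⁻¹ with x ≟ 0#
  ... | yes _   = 0#
  ... | no  x≢0 = proj₁ (inverse x x≢0)

  x*x⁻¹≡1 : ∀ {x} → x ≢ 0# → x * x ⁻¹ ≡ 1#
  x*x⁻¹≡1 {x} x≢0 with x ≟ 0#
  ... | yes x≡0 = contradiction x≡0 x≢0
  ... | no  x≢0 = proj₂ (inverse x x≢0)

  0⁻¹≡0 : 0# ⁻¹ ≡ 0#
  0⁻¹≡0 with 0# ≟ 0#
  ... | yes _   = refl
  ... | no  0≢0 = contradiction refl 0≢0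

  x*y≡1⇒x⁻¹≡y : ∀ {x y} → x * y ≡ 1# → x ⁻¹ ≡ y
  x*y≡1⇒x⁻¹≡y {x} {y} eq = *-cancelˡ-nonZero x≢0 (trans (x*x⁻¹≡1 x≢0) (sym eq))
    where
    x≢0 : x ≢ 0#
    x≢0 x≡0 = 0≢1 (trans (sym (zeroˡ y)) (trans (cong (_* y) (sym x≡0)) eq))

  ⁻¹-nonZero : ∀ {x} → x ≢ 0# → x ⁻¹ ≢ 0#
  ⁻¹-nonZero {x} x≢0 eq = 0≢1 (trans (sym (zeroʳ x)) (trans (cong (x *_) (sym eq)) (x*x⁻¹≡1 x≢0)))

  ⁻¹-involutive : ∀ x → x ⁻¹ ⁻¹ ≡ x
  ⁻¹-involutive x with x ≟ 0#
  ... | yes refl = 0⁻¹≡0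
  ... | no  x≢0  = x*y≡1⇒x⁻¹≡y (trans (*-comm _ x) (proj₂ (inverse x x≢0)))

  -‿⁻¹-comm : ∀ x → (- x) ⁻¹ ≡ - x ⁻¹
  -‿⁻¹-comm x = by-cases (x ≟ 0#)
    where
    by-cases : Dec (x ≡ 0#) → (- x) ⁻¹ ≡ - x ⁻¹
    by-cases (yes refl) = begin
      (- 0#) ⁻¹  ≡⟨ cong _⁻¹ -0#≈0# ⟩
      0# ⁻¹      ≡⟨ 0⁻¹≡0 ⟩
      0#         ≡⟨ -0#≈0# ⟨
      - 0#       ≡⟨ cong -_ 0⁻¹≡0 ⟨
      - 0# ⁻¹    ∎
    by-cases (no x≢0) = x*y≡1⇒x⁻¹≡y (begin
      - x * - x ⁻¹    ≡⟨ -‿distribˡ-* x (- x ⁻¹) ⟨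
      - (x * - x ⁻¹)  ≡⟨ cong -_ (-‿distribʳ-* x (x ⁻¹)) ⟨
      - - (x * x ⁻¹)  ≡⟨ -‿involutive _ ⟩
      x * x ⁻¹        ≡⟨ x*x⁻¹≡1 x≢0 ⟩
      1#              ∎)

  x*2≡x+x : ∀ x → x * 2# ≡ x + x
  x*2≡x+x x = trans (distribˡ x 1# 1#) (cong₂ _+_ (*-identityʳ x) (*-identityʳ x))

  elements : List Carrier
  elements = map (Inverse.to enumeration) (allFin n)

  elements-unique : Unique elements
  elements-unique = Unique.map⁺ (Injection.injective (↔⇒↣ enumeration)) (Unique.allFin⁺ n)

  ∈-elements : ∀ x → x ∈ elements
  ∈-elements x = subst (_∈ elements) (Inverse.strictlyInverseˡ enumeration x)
    (∈-map⁺ _ (∈-allFin (Inverse.from enumeration x)))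

  length-elements : length elements ≡ n
  length-elements = trans (length-map _ (allFin n)) (length-tabulate id)

  nonZeros : List Carrier
  nonZeros = _∖_ _≟_ elements [ 0# ]

  elements↭0∷nonZeros : elements ↭ 0# ∷ nonZeros
  elements↭0∷nonZeros = ↭-∖ _≟_ elements-unique ([] ∷ []) (λ _ → ∈-elements _)

  nonZeros-unique : Unique nonZeros
  nonZeros-unique = Unique.filter⁺ (λ x → ¬? (x ∈? [ 0# ])) elements-unique

  ∈-nonZeros⁺ : ∀ {x} → x ≢ 0# → x ∈ nonZeros
  ∈-nonZeros⁺ x≢0 = ∈-filter⁺ (λ x → ¬? (x ∈? [ 0# ])) (∈-elements _) λ { (here x≡0) → x≢0 x≡0 }

  ∈-nonZeros⁻ : ∀ {x} → x ∈ nonZeros → x ≢ 0#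
  ∈-nonZeros⁻ x∈ x≡0 = proj₂ (∈-filter⁻ (λ x → ¬? (x ∈? [ 0# ])) {xs = elements} x∈) (here x≡0)

  length-nonZeros : n ≡ suc (length nonZeros)
  length-nonZeros = trans (sym length-elements) (Perm.↭-length elements↭0∷nonZeros)

  module _ (n%4≡1 : n % 4 ≡ 1) where

    -- In characteristic 2 the orbits {x, x + 1} would make n even.
    2≢0 : 2# ≢ 0#
    2≢0 2≡0 = contradiction (trans (sym n%2≡1) n%2≡0) λ ()
      where
      orbit : Carrier → List Carrier
      orbit x = x ∷ x + 1# ∷ []
      x+1+1≡x : ∀ x → x + 1# + 1# ≡ x
      x+1+1≡x x = trans (+-assoc x 1# 1#) (trans (cong (x +_) 2≡0) (+-identityʳ x))
      orbit-sym : ∀ {x y} → y ∈ orbit x → x ∈ orbit y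
      orbit-sym (here refl)         = here refl
      orbit-sym (there (here refl)) = there (here (sym (x+1+1≡x _)))
      orbit-trans : ∀ {x y z} → y ∈ orbit x → z ∈ orbit y → z ∈ orbit x
      orbit-trans y∈                  (here refl)         = y∈
      orbit-trans (here refl)         (there (here refl)) = there (here refl)
      orbit-trans (there (here refl)) (there (here refl)) = here (x+1+1≡x _)
      pairs = transversal _≟_ orbit (λ _ → here refl) orbit-sym orbit-trans elements elements-unique
        (λ _ _ → ∈-elements _)
        (λ {x} _ → ((λ x≡x+1 → 0≢1 (sym (+-identityʳ-unique x 1# (sym x≡x+1)))) ∷ []) ∷ [] ∷ [])
      n%2≡0 : n % 2 ≡ 0
      n%2≡0 = trans (cong (_% 2) (trans (sym length-elements)
        (trans (sym (Perm.↭-length (proj₂ pairs))) (length-concatMap orbit 2 (λ _ → refl) (proj₁ pairs)))))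
        ([m+kn]%n≡m%n 0 (length (proj₁ pairs)) 2)
      n%2≡1 : n % 2 ≡ 1
      n%2≡1 = trans (cong (_% 2) (trans (m≡m%n+[m/n]*n n 4)
        (cong₂ Nat._+_ n%4≡1 (sym (ℕ.*-assoc (n / 4) 2 2)))))
        ([m+kn]%n≡m%n 1 (n / 4 Nat.* 2) 2)

    -- Equality would force `x * 2#` to vanish. Negation thus acts freely on the nonzero elements,
    -- which serves both the count behind `√-1` and the later rotation, whose square is negation.
    x≢-x : ∀ {x} → x ≢ 0# → x ≢ - x
    x≢-x {x} x≢0 x≡-x = integral x≢0 2≢0
      (trans (x*2≡x+x x) (trans (cong (x +_) x≡-x) (-‿inverseʳ x)))

    -- Otherwise the orbits {x, -x, 1/x, -1/x} partition the field minus {0, 1, -1},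
    -- and n ≡ 3 modulo 4.
    √-1 : ∃[ ι ] ι * ι ≡ - 1#
    √-1 with any? (λ x → (x * x) ≟ (- 1#)) elements
    ... | yes found = let x , _ , x²≡-1 = find found in x , x²≡-1
    ... | no  none  = contradiction (trans (sym n%4≡1) n%4≡3) λ ()
      where
      x²≢-1 : ∀ x → x * x ≢ - 1#
      x²≢-1 x x²≡-1 = none (lose (∈-elements x) x²≡-1)

      orbit : Carrier → List Carrier
      orbit x = x ∷ - x ∷ x ⁻¹ ∷ - x ⁻¹ ∷ []

      -- A property stable under negation and inversion spreads along orbits. For membership in an
      -- orbit this gives transitivity; for membership in `exceptional` it shows that the ordinary
      -- elements are closed under taking orbits.
      module Closure {P : Carrier → Set} (neg : ∀ {x} → P x → P (- x)) (inv : ∀ {x} → P x → P (x ⁻¹)) where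
        closed : ∀ {x y} → P x → y ∈ orbit x → P y
        closed p (here refl)                         = p
        closed p (there (here refl))                 = neg p
        closed p (there (there (here refl)))         = inv p
        closed p (there (there (there (here refl)))) = neg (inv p)

      orbit-neg : ∀ {x y} → y ∈ orbit x → - y ∈ orbit x
      orbit-neg (here refl)                         = there (here refl)
      orbit-neg (there (here refl))                 = here (-‿involutive _)
      orbit-neg (there (there (here refl)))         = there (there (there (here refl)))
      orbit-neg (there (there (there (here refl)))) = there (there (here (-‿involutive _)))

      orbit-inv : ∀ {x y} → y ∈ orbit x → y ⁻¹ ∈ orbit x
      orbit-inv (here refl)                         = there (there (here refl))
      orbit-inv (there (here refl))                 = there (there (there (here (-‿⁻¹-comm _))))
      orbit-inv (there (there (here refl)))         = here (⁻¹-involutive _)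
      orbit-inv (there (there (there (here refl)))) =
        there (here (trans (-‿⁻¹-comm _) (cong -_ (⁻¹-involutive _))))

      orbit-sym : ∀ {x y} → y ∈ orbit x → x ∈ orbit y
      orbit-sym (here refl)                         = here refl
      orbit-sym (there (here refl))                 = there (here (sym (-‿involutive _)))
      orbit-sym (there (there (here refl)))         = there (there (here (sym (⁻¹-involutive _))))
      orbit-sym (there (there (there (here refl)))) = there (there (there (here (sym
        (trans (cong -_ (-‿⁻¹-comm _)) (trans (-‿involutive _) (⁻¹-involutive _)))))))

      -- Zero, where inversion takes its default value, and the two self-inverse elements: as -1 is
      -- assumed to be a nonsquare, these are the elements whose orbit list has repetitions.
      exceptional : List Carrier
      exceptional = 0# ∷ 1# ∷ - 1# ∷ []

      1⁻¹≡1 : 1# ⁻¹ ≡ 1#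
      1⁻¹≡1 = x*y≡1⇒x⁻¹≡y (*-identityˡ 1#)

      exceptional-neg : ∀ {x} → x ∈ exceptional → - x ∈ exceptional
      exceptional-neg (here refl)                 = here -0#≈0#
      exceptional-neg (there (here refl))         = there (there (here refl))
      exceptional-neg (there (there (here refl))) = there (here (-‿involutive _))

      exceptional-inv : ∀ {x} → x ∈ exceptional → x ⁻¹ ∈ exceptional
      exceptional-inv (here refl)                 = here 0⁻¹≡0
      exceptional-inv (there (here refl))         = there (here 1⁻¹≡1)
      exceptional-inv (there (there (here refl))) =
        there (there (here (trans (-‿⁻¹-comm 1#) (cong -_ 1⁻¹≡1))))

      exceptional-unique : Unique exceptional
      exceptional-unique =
        (0≢1 ∷ (λ 0≡-1 → 0≢1 (-‿injective (trans -0#≈0# 0≡-1))) ∷ []) ∷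
        (x≢-x (0≢1 ∘ sym) ∷ []) ∷ [] ∷ []

      ordinary? : ∀ x → Dec (x ∉ exceptional)
      ordinary? x = ¬? (x ∈? exceptional)

      ordinary : List Carrier
      ordinary = _∖_ _≟_ elements exceptional

      ∈-ordinary⁻ : ∀ {x} → x ∈ ordinary → x ∉ exceptional
      ∈-ordinary⁻ x∈ = proj₂ (∈-filter⁻ ordinary? {xs = elements} x∈)

      -- Every coincidence reduces to `x ≡ - x`, `x ≡ x ⁻¹` or `x ≡ - x ⁻¹`, or to the first of
      -- these for `x ⁻¹`. For nonzero `x` they say 2x = 0, x² = 1 and x² = -1.
      orbit-unique : ∀ {x} → x ∉ exceptional → Unique (orbit x)
      orbit-unique {x} x∉ =
        (x≢-x x≢0 ∷ x≢x⁻¹ ∷ x≢-x⁻¹ ∷ []) ∷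
        ((λ e → x≢-x⁻¹ (trans (sym (-‿involutive x)) (cong -_ e))) ∷ (x≢x⁻¹ ∘ -‿injective) ∷ []) ∷
        (x≢-x (⁻¹-nonZero x≢0) ∷ []) ∷ [] ∷ []
        where
        x≢0 : x ≢ 0#
        x≢0 x≡0 = x∉ (here x≡0)
        x≢x⁻¹ : x ≢ x ⁻¹
        x≢x⁻¹ e = [ x∉ ∘ there ∘ here , x∉ ∘ there ∘ there ∘ here ]′
          (x²≡1⇒x≡1⊎x≡-1 x (trans (cong (x *_) e) (x*x⁻¹≡1 x≢0)))
        x≢-x⁻¹ : x ≢ - x ⁻¹
        x≢-x⁻¹ e = x²≢-1 x (trans (cong (x *_) e)
          (trans (sym (-‿distribʳ-* x (x ⁻¹))) (cong -_ (x*x⁻¹≡1 x≢0))))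

      quadruples = transversal _≟_ orbit (λ _ → here refl) orbit-sym
        (Closure.closed orbit-neg orbit-inv)
        ordinary (Unique.filter⁺ ordinary? elements-unique)
        (λ x∈ y∈ → ∈-filter⁺ ordinary? (∈-elements _)
          λ y∈exc → ∈-ordinary⁻ x∈ (Closure.closed exceptional-neg exceptional-inv y∈exc (orbit-sym y∈)))
        (orbit-unique ∘ ∈-ordinary⁻)

      n%4≡3 : n % 4 ≡ 3
      n%4≡3 = trans (cong (_% 4) (trans (sym length-elements)
        (trans (Perm.↭-length (↭-∖ _≟_ elements-unique exceptional-unique (λ _ → ∈-elements _)))
        (cong (3 Nat.+_) (trans (sym (Perm.↭-length (proj₂ quadruples)))
          (length-concatMap orbit 4 (λ _ → refl) (proj₁ quadruples)))))))
        ([m+kn]%n≡m%n 3 (length (proj₁ quadruples)) 4)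

    -- Multiplication by a square root of -1

    ι : Carrier
    ι = proj₁ √-1

    rotate : Carrier → Carrier
    rotate x = ι * x

    -- It has two uses: with equal arguments, rotation negates a square in F; with a scalar and a
    -- second coordinate, rotating both negates their product in K.
    ιx*ιy≡-xy : ∀ x y → rotate x * rotate y ≡ - (x * y)
    ιx*ιy≡-xy x y = begin
      ι * x * (ι * y)    ≡⟨ *-assoc ι x (ι * y) ⟩
      ι * (x * (ι * y))  ≡⟨ cong (ι *_) (begin
        x * (ι * y)        ≡⟨ *-assoc x ι y ⟨
        x * ι * y          ≡⟨ cong (_* y) (*-comm x ι) ⟩
        ι * x * y          ≡⟨ *-assoc ι x y ⟩
        ι * (x * y)        ∎) ⟩
      ι * (ι * (x * y))  ≡⟨ *-assoc ι ι (x * y) ⟨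
      ι * ι * (x * y)    ≡⟨ cong (_* (x * y)) (proj₂ √-1) ⟩
      - 1# * (x * y)     ≡⟨ -1*x≈-x (x * y) ⟩
      - (x * y)          ∎

    rotate² : ∀ x → rotate (rotate x) ≡ - x
    rotate² x = trans (sym (*-assoc ι ι x)) (trans (cong (_* x) (proj₂ √-1)) (-1*x≈-x x))

    rotate⁴ : ∀ x → rotate (rotate (rotate (rotate x))) ≡ x
    rotate⁴ x = trans (rotate² _) (trans (cong -_ (rotate² x)) (-‿involutive x))

    ι≢0 : ι ≢ 0#
    ι≢0 ι≡0 = 0≢1 (-‿injective (begin
      - 0#   ≡⟨ -0#≈0# ⟩
      0#     ≡⟨ zeroˡ ι ⟨
      0# * ι ≡⟨ cong (_* ι) ι≡0 ⟨
      ι * ι  ≡⟨ proj₂ √-1 ⟩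
      - 1#   ∎))

    abstract
      -- Rotating twice is negation, which fixes no nonzero element, so all orbits have four
      -- elements. The choice of representatives is kept opaque; later arguments rely only on the
      -- permutation.
      nonZeros-transversal : ∃[ reps ] concatMap (orbit₄ rotate) reps ↭ nonZeros
      nonZeros-transversal = transversal₄ rotate rotate⁴ _≟_ nonZeros-unique
        (λ x∈ → ∈-nonZeros⁺ (integral ι≢0 (∈-nonZeros⁻ x∈)))
        (λ x∈ e → x≢-x (∈-nonZeros⁻ x∈) (trans (sym e) (rotate² _)))

    reps : List Carrier
    reps = proj₁ nonZeros-transversal

    orbits↭nonZeros : concatMap (orbit₄ rotate) reps ↭ nonZeros
    orbits↭nonZeros = proj₂ nonZeros-transversal

    n≡1+4*reps : n ≡ suc (length reps Nat.* 4)
    n≡1+4*reps = trans length-nonZeros (cong suc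
      (trans (sym (Perm.↭-length orbits↭nonZeros)) (length-concatMap (orbit₄ rotate) 4 (λ _ → refl) reps)))

-- Differences of blocks

toList≡map-lookup : ∀ {k} (v : Vec A k) → toList v ≡ map (lookup v) (allFin k)
toList≡map-lookup {A = A} v = trans (go v) (sym (map-tabulate id (lookup v)))
  where
  go : ∀ {k} (v : Vec A k) → toList v ≡ tabulate (lookup v)
  go Vec.[]      = refl
  go (x Vec.∷ v) = cong (x ∷_) (go v)

∑-toList : ∀ {k} (f : A → ℕ) (v : Vec A k) → ∑ f (toList v) ≡ ∑ (f ∘ lookup v) (allFin k)
∑-toList f v = trans (cong (∑ f) (toList≡map-lookup v)) (∑-map f (lookup v) (allFin _))

lookup-injective : ∀ {k} (v : Vec A k) → Unique (toList v) → Injective _≡_ _≡_ (lookup v)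
lookup-injective v v! = Unique-map-injective (lookup v)
  (subst Unique (toList≡map-lookup v) v!) (∈-allFin _) (∈-allFin _)

module _ {G : Set} (_≟_ : DecidableEquality G) (_-_ : Op₂ G) (N : G → Set) where
  open RelativeDF _≟_ _-_ N

  -- `differences` leaves out the diagonal by comparing indices, the double sum by comparing
  -- entries; the two agree because the entries are distinct. The sum no longer refers to positions
  -- and can be reindexed by any permutation of the block.
  multiplicity-differences : ∀ {k} (v : Vec G k) → Unique (toList v) → ∀ g →
    multiplicity g (differences v) ≡
    ∑ (λ x → ∑ (λ y → 𝟙 (¬? (x ≟ y)) Nat.* 𝟙 (g ≟ (x - y))) (toList v)) (toList v)
  multiplicity-differences {k} v v! g = begin
    multiplicity g (differences v)
      ≡⟨ length-filter≡∑ (g ≟_) (differences v) ⟩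
    ∑ (λ x → 𝟙 (g ≟ x)) (differences v)
      ≡⟨ ∑-concatMap _ _ (allFin k) ⟩
    ∑ (λ i → ∑ (λ x → 𝟙 (g ≟ x)) (concatMap (difference i) (allFin k))) (allFin k)
      ≡⟨ ∑-cong (allFin k) (λ {i} _ → trans (∑-concatMap _ (difference i) (allFin k))
           (∑-cong (allFin k) (λ {j} _ → ∑-difference i j))) ⟩
    ∑ (λ i → ∑ (λ j → term (lookup v i) (lookup v j)) (allFin k)) (allFin k)
      ≡⟨ ∑-cong (allFin k) (λ {i} _ → ∑-toList (term (lookup v i)) v) ⟨
    ∑ (λ i → ∑ (term (lookup v i)) (toList v)) (allFin k)
      ≡⟨ ∑-toList (λ x → ∑ (term x) (toList v)) v ⟨
    ∑ (λ x → ∑ (term x) (toList v)) (toList v)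
      ∎
    where
    open ≡-Reasoning
    term : G → G → ℕ
    term x y = 𝟙 (¬? (x ≟ y)) Nat.* 𝟙 (g ≟ (x - y))
    difference : Fin k → Fin k → List G
    difference i j = if does (i Fin.≟ j) then [] else [ lookup v i - lookup v j ]
    ∑-difference : ∀ i j → ∑ (λ x → 𝟙 (g ≟ x)) (difference i j) ≡ term (lookup v i) (lookup v j)
    ∑-difference i j with i Fin.≟ j
    ... | yes refl = sym (𝟙-no-* (¬? (lookup v i ≟ lookup v i)) (λ ≢ → ≢ refl) _)
    ... | no  i≢j  = trans (ℕ.+-identityʳ _)
      (sym (𝟙-yes-* (¬? (lookup v i ≟ lookup v j)) (i≢j ∘ lookup-injective v v!) _))

-- With x = u + y the equation x² - y² = d becomes u (u + 2 y) = d, linear in y.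
module _ {n : ℕ} (F : FiniteField n) (n%4≡1 : n % 4 ≡ 1) where
  open Field F
  open ≡-Reasoning

  [u+y]²-y²≡u[u+y*2] : ∀ u y → (u + y) * (u + y) - y * y ≡ u * (u + y * 2#)
  [u+y]²-y²≡u[u+y*2] u y = trans (x²-y²≡[x-y][x+y] (u + y) y)
    (cong₂ _*_ (trans (cong (_- y) (+-comm u y)) (xyx⁻¹≈y y u))
               (trans (+-assoc u y y) (cong (u +_) (sym (x*2≡x+x y)))))

  module _ (d u : Carrier) (u≢0 : u ≢ 0#) where
    solution : Carrier
    solution = (d * u ⁻¹ - u) * 2# ⁻¹

    cancel : ∀ {z} → z ≢ 0# → ∀ w → w * z ⁻¹ * z ≡ w
    cancel {z} z≢0 w = trans (*-assoc w _ z)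
      (trans (cong (w *_) (trans (*-comm _ z) (x*x⁻¹≡1 z≢0))) (*-identityʳ w))

    solution-correct : u * (u + solution * 2#) ≡ d
    solution-correct = begin
      u * (u + solution * 2#)        ≡⟨ cong (λ w → u * (u + w)) (cancel (2≢0 n%4≡1) _) ⟩
      u * (u + (d * u ⁻¹ - u))       ≡⟨ cong (u *_) (trans (+-comm u _) (//-rightDividesˡ u _)) ⟩
      u * (d * u ⁻¹)                 ≡⟨ trans (*-comm u _) (cancel u≢0 d) ⟩
      d                              ∎

    solution-unique : ∀ {y z} → u * (u + y * 2#) ≡ u * (u + z * 2#) → y ≡ z
    solution-unique {y} {z} eq = *-cancelˡ-nonZero (2≢0 n%4≡1)
      (trans (*-comm 2# y) (trans (+-cancelˡ u _ _ (*-cancelˡ-nonZero u≢0 eq)) (*-comm z 2#)))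

  elements-shift : ∀ y → elements ↭ map (_+ y) elements
  elements-shift y = unique∧set⇒↭ elements-unique (Unique.map⁺ (+-cancelʳ y _ _) elements-unique)
    (λ {x} _ → subst (_∈ map (_+ y) elements) (//-rightDividesˡ y x) (∈-map⁺ (_+ y) (∈-elements (x - y))))
    (λ _ → ∈-elements _)

  -- The difference u = 0 is the diagonal and is cancelled by the distinctness factor; every other u
  -- admits one y. The case d = 0 is no exception: there the pairs are those with x = -y.
  ∑-squareDifferences : ∀ d →
    ∑ (λ x → ∑ (λ y → 𝟙 (¬? (x ≟ y)) Nat.* 𝟙 (d ≟ (x * x - y * y))) elements) elements ≡ n ∸ 1
  ∑-squareDifferences d = begin
    ∑ (λ x → ∑ (λ y → term x y) elements) elements
      ≡⟨ ∑-comm term elements elements ⟩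
    ∑ (λ y → ∑ (λ x → term x y) elements) elements
      ≡⟨ ∑-cong elements (λ {y} _ → trans (∑-↭ (λ x → term x y) (elements-shift y))
                                          (∑-map (λ x → term x y) (_+ y) elements)) ⟩
    ∑ (λ y → ∑ (λ u → term (u + y) y) elements) elements
      ≡⟨ ∑-comm (λ y u → term (u + y) y) elements elements ⟩
    ∑ (λ u → ∑ (λ y → term (u + y) y) elements) elements
      ≡⟨ ∑-↭ (λ u → ∑ (λ y → term (u + y) y) elements) elements↭0∷nonZeros ⟩
    ∑ (λ y → term (0# + y) y) elements Nat.+ ∑ (λ u → ∑ (λ y → term (u + y) y) elements) nonZeros
      ≡⟨ cong₂ Nat._+_
           (∑-zero elements λ {y} _ → 𝟙-no-* (¬? ((0# + y) ≟ y)) (λ ≢ → ≢ (+-identityˡ y)) _)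
           (∑-cong nonZeros λ u∈ → one-solution (∈-nonZeros⁻ u∈)) ⟩
    ∑ (λ _ → 1) nonZeros
      ≡⟨ trans (∑-const 1 nonZeros) (ℕ.*-identityʳ _) ⟩
    length nonZeros
      ≡⟨ cong (_∸ 1) length-nonZeros ⟨
    n ∸ 1
      ∎
    where
    term : Carrier → Carrier → ℕ
    term x y = 𝟙 (¬? (x ≟ y)) Nat.* 𝟙 (d ≟ (x * x - y * y))

    one-solution : ∀ {u} → u ≢ 0# → ∑ (λ y → term (u + y) y) elements ≡ 1
    one-solution {u} u≢0 = trans
      (∑-cong elements λ {y} _ →
        𝟙-yes-* (¬? ((u + y) ≟ y)) (λ u+y≡y → u≢0 (+-identityˡ-unique u y u+y≡y)) _)
      (∑-𝟙-∃! (λ y → d ≟ ((u + y) * (u + y) - y * y)) elements-unique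
        (∈-elements (solution d u u≢0))
        (trans (sym (solution-correct d u u≢0)) (sym ([u+y]²-y²≡u[u+y*2] u _)))
        (λ {y} d≡ → solution-unique d u u≢0 (trans (sym ([u+y]²-y²≡u[u+y*2] u y))
          (trans (sym d≡) (sym (solution-correct d u u≢0))))))

-- The base block

-- Equivariant maps carry orbits to orbits; the cases of interest are the two projections from pairs
-- rotated in both coordinates.
map-orbit₄ : ∀ (f : A → A) (g : B → B) (h : A → B) → (∀ x → h (f x) ≡ g (h x)) →
             ∀ xs → map h (concatMap (orbit₄ f) xs) ≡ concatMap (orbit₄ g) (map h xs)
map-orbit₄ f g h hf≗gh xs = trans (map-concatMap h (orbit₄ f) xs)
  (trans (concatMap-cong orbits xs) (sym (concatMap-map (orbit₄ g) h xs)))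
  where
  hff≡ggh : ∀ x → h (f (f x)) ≡ g (g (h x))
  hff≡ggh x = trans (hf≗gh (f x)) (cong g (hf≗gh x))
  orbits : ∀ x → map h (orbit₄ f x) ≡ orbit₄ g (h x)
  orbits x = cong (h x ∷_) (cong₂ _∷_ (hf≗gh x) (cong₂ _∷_ (hff≡ggh x)
    (cong [_] (trans (hff≡ggh (f x)) (cong (g ∘ g) (hf≗gh x))))))

map-proj₁-zip : ∀ (xs : List A) (ys : List B) → length xs ≤ length ys → map proj₁ (zip xs ys) ≡ xs
map-proj₁-zip []       ys       _        = refl
map-proj₁-zip (x ∷ xs) (y ∷ ys) (s≤s le) = cong (x ∷_) (map-proj₁-zip xs ys le)

map-proj₂-zip : ∀ (xs : List A) (ys : List B) → map proj₂ (zip xs ys) ≡ take (length xs) ys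
map-proj₂-zip []       ys       = refl
map-proj₂-zip (x ∷ xs) []       = refl
map-proj₂-zip (x ∷ xs) (y ∷ ys) = cong (y ∷_) (map-proj₂-zip xs ys)

listToVec : ∀ (xs : List A) {k} → length xs ≡ k → ∃ λ (v : Vec A k) → toList v ≡ xs
listToVec xs refl = Vec.fromList xs , Vec.toList∘fromList xs

module Construction {p q : ℕ} (p%4≡1 : p % 4 ≡ 1) (q%4≡1 : q % 4 ≡ 1) (p≤q : p ≤ q)
                    (F : FiniteField p) (K : FiniteField q) where

  module F = Field F
  module K = Field K
  open ≡-Reasoning

  Point : Set
  Point = F.Carrier × K.Carrier

  rotateF : F.Carrier → F.Carrier
  rotateF = F.rotate p%4≡1

  rotateK : K.Carrier → K.Carrier
  rotateK = K.rotate q%4≡1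

  rotate : Point → Point
  rotate = Product.map rotateF rotateK

  repsF : List F.Carrier
  repsF = F.reps p%4≡1

  repsK : List K.Carrier
  repsK = K.reps q%4≡1

  -- The lengths are (p - 1)/4 and (q - 1)/4. This is where `p≤q` enters: each orbit of F can
  -- receive its own orbit of K.
  repsF≤repsK : length repsF ≤ length repsK
  repsF≤repsK = ℕ.*-cancelʳ-≤ _ _ 4 (ℕ.≤-pred (subst₂ _≤_ (F.n≡1+4*reps p%4≡1) (K.n≡1+4*reps q%4≡1) p≤q))

  -- The graph of an injection from F into K that sends 0 to 0 and intertwines the
  -- multiplications by the chosen square roots of -1.
  graph : List Point
  graph = (F.0# , K.0#) ∷ concatMap (orbit₄ rotate) (zip repsF repsK)

  rotate⁴ : ∀ z → rotate (rotate (rotate (rotate z))) ≡ z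
  rotate⁴ (x , y) = cong₂ _,_ (F.rotate⁴ p%4≡1 x) (K.rotate⁴ q%4≡1 y)

  graph-rotate : map rotate graph ↭ graph
  graph-rotate = ↭-trans
    (↭-reflexive (cong (_∷ map rotate (concatMap (orbit₄ rotate) (zip repsF repsK)))
      (cong₂ _,_ (F.zeroʳ _) (K.zeroʳ _))))
    (prep _ (concatMap-orbit₄-rotate rotate rotate⁴ (zip repsF repsK)))

  -- `zip` stops at the end of the shorter list, which by `repsF≤repsK` loses no representative of
  -- F.
  proj₁-graph : map proj₁ graph ↭ F.elements
  proj₁-graph = ↭-trans
    (prep F.0# (↭-trans
      (↭-reflexive (trans (map-orbit₄ rotate rotateF proj₁ (λ _ → refl) (zip repsF repsK))
        (cong (concatMap (orbit₄ rotateF)) (map-proj₁-zip repsF repsK repsF≤repsK))))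
      (F.orbits↭nonZeros p%4≡1)))
    (↭-sym F.elements↭0∷nonZeros)

  -- The second coordinates are zero and the orbits of the first `length repsF` representatives, an
  -- initial segment of a duplicate-free enumeration of K.
  proj₂-graph-unique : Unique (map proj₂ graph)
  proj₂-graph-unique = subst Unique (sym (cong (K.0# ∷_) orbits))
    (Unique-++⁻ˡ (K.0# ∷ concatMap (orbit₄ rotateK) (take m repsK))
      (subst (Unique ∘ (K.0# ∷_)) split
        (Unique-resp-↭ (↭-trans K.elements↭0∷nonZeros (prep K.0# (↭-sym (K.orbits↭nonZeros q%4≡1))))
          K.elements-unique)))
    where
    m = length repsF
    orbits : map proj₂ (concatMap (orbit₄ rotate) (zip repsF repsK)) ≡ concatMap (orbit₄ rotateK) (take m repsK)
    orbits = trans (map-orbit₄ rotate rotateK proj₂ (λ _ → refl) (zip repsF repsK))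
      (cong (concatMap (orbit₄ rotateK)) (map-proj₂-zip repsF repsK))
    split : concatMap (orbit₄ rotateK) repsK ≡
            concatMap (orbit₄ rotateK) (take m repsK) ++ concatMap (orbit₄ rotateK) (drop m repsK)
    split = trans (cong (concatMap (orbit₄ rotateK)) (sym (take++drop≡id m repsK)))
      (concatMap-++ (orbit₄ rotateK) (take m repsK) (drop m repsK))

  proj₁-graph-injective : ∀ {z w} → z ∈ graph → w ∈ graph → proj₁ z ≡ proj₁ w → z ≡ w
  proj₁-graph-injective =
    Unique-map-injective proj₁ (Unique-resp-↭ (↭-sym proj₁-graph) F.elements-unique)

  proj₂-graph-injective : ∀ {z w} → z ∈ graph → w ∈ graph → proj₂ z ≡ proj₂ w → z ≡ w
  proj₂-graph-injective = Unique-map-injective proj₂ proj₂-graph-unique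

  length-graph : length graph ≡ p
  length-graph = trans (sym (length-map proj₁ graph)) (trans (Perm.↭-length proj₁-graph) F.length-elements)

  graphVec : ∃ λ (v : Vec Point p) → toList v ≡ graph
  graphVec = listToVec graph length-graph

  scale : K.Carrier → Point → Point
  scale s (x , y) = x F.* x , s K.* y

  block : K.Carrier → Vec Point p
  block s = Vec.map (scale s) (proj₁ graphVec)

  toList-block : ∀ s → toList (block s) ≡ map (scale s) graph
  toList-block s = trans (Vec.toList-map (scale s) (proj₁ graphVec)) (cong (map (scale s)) (proj₂ graphVec))

  -- Distinctness has to come from the second coordinate, since squaring identifies `x` and `- x` in
  -- the first.
  block-unique : ∀ {s} → s ≢ K.0# → Unique (toList (block s))
  block-unique {s} s≢0 = subst Unique (sym (toList-block s)) (Unique.map⁻ {f = proj₂}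
    (subst Unique (trans (sym (map-∘ graph)) (map-∘ graph))
      (Unique.map⁺ {f = s K.*_} (K.*-cancelˡ-nonZero s≢0) proj₂-graph-unique)))

  blocks : List (Vec Point p)
  blocks = map block repsK

  repsK-nonZero : ∀ {s} → s ∈ repsK → s ≢ K.0#
  repsK-nonZero s∈ = K.∈-nonZeros⁻ (Perm.∈-resp-↭ (K.orbits↭nonZeros q%4≡1) (∈-reps s∈))
    where
    ∈-reps : ∀ {s ss} → s ∈ ss → s ∈ concatMap (orbit₄ rotateK) ss
    ∈-reps (here refl)           = here refl
    ∈-reps {ss = t ∷ _} (there s∈) = ∈-++⁺ʳ (orbit₄ rotateK t) (∈-reps s∈)

  open RelativeDF (_≟×_ F K) (_-×_ F K) (InFx0 F K)

  -- Counting the occurrences of a difference `(d , l)`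

  module Count (d : F.Carrier) (l : K.Carrier) where

    -- Points of the graph are told apart by their K-coordinates before scaling. The test is then
    -- independent of the scalar and can be pulled out of a sum over scalars.
    distinct : K.Carrier → K.Carrier → ℕ
    distinct y y′ = 𝟙 (¬? (y K.≟ y′))

    squareTerm : F.Carrier → F.Carrier → ℕ
    squareTerm x x′ = 𝟙 (d F.≟ (x F.* x F.- x′ F.* x′))

    scaledTerm : K.Carrier → K.Carrier → K.Carrier → ℕ
    scaledTerm s y y′ = 𝟙 (l K.≟ (s K.* y K.- s K.* y′))

    term : K.Carrier → Point → Point → ℕ
    term s (x , y) (x′ , y′) = distinct y y′ Nat.* (squareTerm x x′ Nat.* scaledTerm s y y′)

    count : K.Carrier → ℕ
    count s = ∑ (λ z → ∑ (term s z) graph) graph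

    multiplicity-block : ∀ {s} → s ≢ K.0# → multiplicity (d , l) (differences (block s)) ≡ count s
    multiplicity-block {s} s≢0 = begin
      multiplicity (d , l) (differences (block s))
        ≡⟨ multiplicity-differences (_≟×_ F K) (_-×_ F K) (InFx0 F K) (block s) (block-unique s≢0) (d , l) ⟩
      ∑ (λ z → ∑ (pair z) (toList (block s))) (toList (block s))
        ≡⟨ cong (λ zs → ∑ (λ z → ∑ (pair z) zs) zs) (toList-block s) ⟩
      ∑ (λ z → ∑ (pair z) (map (scale s) graph)) (map (scale s) graph)
        ≡⟨ ∑-map _ (scale s) graph ⟩
      ∑ (λ z → ∑ (pair (scale s z)) (map (scale s) graph)) graph
        ≡⟨ ∑-cong graph (λ {z} z∈ → trans (∑-map (pair (scale s z)) (scale s) graph)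
             (∑-cong graph (pair≡term z∈))) ⟩
      count s
        ∎
      where
      pair : Point → Point → ℕ
      pair z w = 𝟙 (¬? (_≟×_ F K z w)) Nat.* 𝟙 (_≟×_ F K (d , l) (_-×_ F K z w))
      pair≡term : ∀ {z} → z ∈ graph → ∀ {w} → w ∈ graph → pair (scale s z) (scale s w) ≡ term s z w
      pair≡term {z@(x , y)} z∈ {w@(x′ , y′)} w∈ = cong₂ Nat._*_
        (𝟙-cong (¬? (_≟×_ F K (scale s z) (scale s w))) (¬? (y K.≟ y′))
          (λ z≢w y≡y′ → z≢w (cong (scale s) (proj₂-graph-injective z∈ w∈ y≡y′)))
          (λ y≢y′ z≡w → y≢y′ (K.*-cancelˡ-nonZero s≢0 (cong proj₂ z≡w))))
        (𝟙-× (d F.≟ (x F.* x F.- x′ F.* x′)) (l K.≟ (s K.* y K.- s K.* y′))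
          (_≟×_ F K (d , l) (_-×_ F K (scale s z) (scale s w)))
          (λ e → cong proj₁ e , cong proj₂ e) (cong₂ _,_))

    multiplicity-blocks : multiplicity (d , l) (allDifferences blocks) ≡ ∑ count repsK
    multiplicity-blocks = begin
      multiplicity (d , l) (allDifferences blocks)
        ≡⟨ length-filter≡∑ (_≟×_ F K (d , l)) (allDifferences blocks) ⟩
      ∑ (λ z → 𝟙 (_≟×_ F K (d , l) z)) (allDifferences blocks)
        ≡⟨ trans (∑-concatMap _ differences blocks) (∑-map _ block repsK) ⟩
      ∑ (λ s → ∑ (λ z → 𝟙 (_≟×_ F K (d , l) z)) (differences (block s))) repsK
        ≡⟨ ∑-cong repsK (λ {s} s∈ → trans
             (sym (length-filter≡∑ (_≟×_ F K (d , l)) (differences (block s))))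
             (multiplicity-block (repsK-nonZero s∈))) ⟩
      ∑ count repsK
        ∎

    -- For nonzero `s`, distinct second coordinates stay distinct after scaling, so their difference
    -- cannot be zero.
    count-zero : l ≡ K.0# → ∀ {s} → s ≢ K.0# → count s ≡ 0
    count-zero refl {s} s≢0 = ∑-zero graph λ {z} _ → ∑-zero graph λ {w} _ → term≡0 z w
      where
      term≡0 : ∀ z w → term s z w ≡ 0
      term≡0 (x , y) (x′ , y′) = by-cases (y K.≟ y′)
        where
        by-cases : Dec (y ≡ y′) → term s (x , y) (x′ , y′) ≡ 0
        by-cases (yes y≡y′) = 𝟙-no-* (¬? (y K.≟ y′)) (λ y≢y′ → y≢y′ y≡y′) _
        by-cases (no  y≢y′) = trans (cong (λ m → distinct y y′ Nat.* (squareTerm x x′ Nat.* m))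
            (𝟙-no (l K.≟ (s K.* y K.- s K.* y′))
              λ 0≡ → y≢y′ (K.*-cancelˡ-nonZero s≢0 (K.x∙y⁻¹≈ε⇒x≈y _ _ (sym 0≡)))))
          (trans (cong (distinct y y′ Nat.*_) (ℕ.*-zeroʳ (squareTerm x x′))) (ℕ.*-zeroʳ (distinct y y′)))

    -- Rotating both points negates the difference of squares in F and, after scaling by the
    -- square root of -1, the difference in K: this exchanges the two points.
    term-rotate : ∀ s z w → term (rotateK s) (rotate z) (rotate w) ≡ term s w z
    term-rotate s (x , y) (x′ , y′) = cong₂ Nat._*_
      (𝟙-cong (¬? (rotateK y K.≟ rotateK y′)) (¬? (y′ K.≟ y))
        (λ ≢ y′≡y → ≢ (cong rotateK (sym y′≡y)))
        (λ ≢ e → ≢ (sym (K.*-cancelˡ-nonZero (K.ι≢0 q%4≡1) e))))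
      (cong₂ Nat._*_
        (cong (λ e → 𝟙 (d F.≟ e)) (trans
          (cong₂ F._-_ (F.ιx*ιy≡-xy p%4≡1 x x) (F.ιx*ιy≡-xy p%4≡1 x′ x′)) (F.[-x]-[-y]≡y-x _ _)))
        (cong (λ e → 𝟙 (l K.≟ e)) (trans
          (cong₂ K._-_ (K.ιx*ιy≡-xy q%4≡1 s y) (K.ιx*ιy≡-xy q%4≡1 s y′)) (K.[-x]-[-y]≡y-x _ _))))

    -- Since rotation permutes the graph, both summation variables may be rotated; exchanging the
    -- two sums then absorbs the swap of points in `term-rotate`.
    count-rotate : ∀ s → count (rotateK s) ≡ count s
    count-rotate s = begin
      ∑ (λ z → ∑ (term (rotateK s) z) graph) graph
        ≡⟨ ∑-graph-rotate _ ⟩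
      ∑ (λ z → ∑ (term (rotateK s) (rotate z)) graph) graph
        ≡⟨ ∑-cong graph (λ {z} _ → trans (∑-graph-rotate (term (rotateK s) (rotate z)))
             (∑-cong graph (λ {w} _ → term-rotate s z w))) ⟩
      ∑ (λ z → ∑ (λ w → term s w z) graph) graph
        ≡⟨ ∑-comm (λ z w → term s w z) graph graph ⟩
      ∑ (λ w → ∑ (term s w) graph) graph
        ∎
      where
      ∑-graph-rotate : ∀ f → ∑ f graph ≡ ∑ (f ∘ rotate) graph
      ∑-graph-rotate f = trans (∑-↭ f (↭-sym graph-rotate)) (∑-map f rotate graph)

    ∑-count-orbit : ∀ s → ∑ count (orbit₄ rotateK s) ≡ 4 Nat.* count s
    ∑-count-orbit s = cong (count s Nat.+_) (cong₂ Nat._+_ r₁ (cong₂ Nat._+_ r₂ (cong (Nat._+ 0) r₃)))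
      where
      r₁ = count-rotate s
      r₂ = trans (count-rotate _) r₁
      r₃ = trans (count-rotate _) r₂

    4*∑-count : 4 Nat.* ∑ count repsK ≡ ∑ count K.nonZeros
    4*∑-count = begin
      4 Nat.* ∑ count repsK                           ≡⟨ ∑-distribˡ-* 4 count repsK ⟨
      ∑ (λ s → 4 Nat.* count s) repsK                 ≡⟨ ∑-cong repsK (λ {s} _ → ∑-count-orbit s) ⟨
      ∑ (λ s → ∑ count (orbit₄ rotateK s)) repsK      ≡⟨ ∑-concatMap count (orbit₄ rotateK) repsK ⟨
      ∑ count (concatMap (orbit₄ rotateK) repsK)      ≡⟨ ∑-↭ count (K.orbits↭nonZeros q%4≡1) ⟩
      ∑ count K.nonZeros                              ∎

    module _ (l≢0 : l ≢ K.0#) where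

      ∑-scalars : ∀ {y y′} → y ≢ y′ → ∑ (λ s → scaledTerm s y y′) K.nonZeros ≡ 1
      ∑-scalars {y} {y′} y≢y′ = ∑-𝟙-∃! (λ s → l K.≟ (s K.* y K.- s K.* y′)) K.nonZeros-unique
        -- The only candidate is l/(y - y′), and `l≢0` makes it a nonzero scalar.
        (K.∈-nonZeros⁺ (K.integral l≢0 (K.⁻¹-nonZero δ≢0)))
        (trans (sym lδ⁻¹δ≡l) (K.x[y-z]≈xy-xz _ y y′))
        λ {s} l≡ → K.*-cancelˡ-nonZero δ≢0 (trans (K.*-comm δ s)
          (trans (K.x[y-z]≈xy-xz s y y′) (trans (sym l≡) (trans (sym lδ⁻¹δ≡l) (K.*-comm _ δ)))))
        where
        δ = y K.- y′
        δ≢0 : δ ≢ K.0#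
        δ≢0 = y≢y′ ∘ K.x∙y⁻¹≈ε⇒x≈y _ _
        lδ⁻¹δ≡l : l K.* δ K.⁻¹ K.* δ ≡ l
        lδ⁻¹δ≡l = trans (K.*-assoc l _ δ) (trans (cong (l K.*_)
          (trans (K.*-comm _ δ) (K.x*x⁻¹≡1 δ≢0))) (K.*-identityʳ l))

      distinctSquareTerm : F.Carrier → F.Carrier → ℕ
      distinctSquareTerm x x′ = 𝟙 (¬? (x F.≟ x′)) Nat.* squareTerm x x′

      -- On the graph either coordinate determines the point, so distinctness can be tested in F
      -- instead of K. What remains is a question about F alone.
      ∑-term : ∀ {z} → z ∈ graph → ∀ {w} → w ∈ graph →
               ∑ (λ s → term s z w) K.nonZeros ≡ distinctSquareTerm (proj₁ z) (proj₁ w)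
      ∑-term {z@(x , y)} z∈ {w@(x′ , y′)} w∈ = begin
        ∑ (λ s → term s z w) K.nonZeros
          ≡⟨ trans (∑-distribˡ-* (distinct y y′) (λ s → squareTerm x x′ Nat.* scaledTerm s y y′) K.nonZeros)
               (cong (distinct y y′ Nat.*_)
                 (∑-distribˡ-* (squareTerm x x′) (λ s → scaledTerm s y y′) K.nonZeros)) ⟩
        distinct y y′ Nat.* (squareTerm x x′ Nat.* ∑ (λ s → scaledTerm s y y′) K.nonZeros)
          ≡⟨ by-cases (y K.≟ y′) ⟩
        distinctSquareTerm x x′
          ∎
        where
        by-cases : Dec (y ≡ y′) →
          distinct y y′ Nat.* (squareTerm x x′ Nat.* ∑ (λ s → scaledTerm s y y′) K.nonZeros)
            ≡ distinctSquareTerm x x′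
        by-cases (yes y≡y′) = trans (𝟙-no-* (¬? (y K.≟ y′)) (λ y≢y′ → y≢y′ y≡y′) _)
          (sym (𝟙-no-* (¬? (x F.≟ x′)) (λ x≢x′ → x≢x′ (cong proj₁ (proj₂-graph-injective z∈ w∈ y≡y′))) _))
        by-cases (no y≢y′) = trans (𝟙-yes-* (¬? (y K.≟ y′)) y≢y′ _)
          (trans (cong (squareTerm x x′ Nat.*_) (∑-scalars y≢y′)) (trans (ℕ.*-identityʳ _)
            (sym (𝟙-yes-* (¬? (x F.≟ x′))
              (λ x≡x′ → y≢y′ (cong proj₂ (proj₁-graph-injective z∈ w∈ x≡x′))) _))))

      ∑-count-nonZeros : ∑ count K.nonZeros ≡ p ∸ 1
      ∑-count-nonZeros = begin
        ∑ count K.nonZeros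
          ≡⟨ ∑-comm (λ s z → ∑ (term s z) graph) K.nonZeros graph ⟩
        ∑ (λ z → ∑ (λ s → ∑ (term s z) graph) K.nonZeros) graph
          ≡⟨ ∑-cong graph (λ {z} z∈ → trans (∑-comm (λ s → term s z) K.nonZeros graph)
               (∑-cong graph (∑-term z∈))) ⟩
        ∑ (λ z → ∑ (λ w → distinctSquareTerm (proj₁ z) (proj₁ w)) graph) graph
          -- The summand depends on first coordinates only, and these run through F exactly once.
          ≡⟨ ∑-cong graph (λ {z} _ → ∑-graph-proj₁ (distinctSquareTerm (proj₁ z))) ⟩
        ∑ (λ z → ∑ (distinctSquareTerm (proj₁ z)) F.elements) graph
          ≡⟨ ∑-graph-proj₁ (λ x → ∑ (distinctSquareTerm x) F.elements) ⟩
        ∑ (λ x → ∑ (distinctSquareTerm x) F.elements) F.elements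
          ≡⟨ ∑-squareDifferences F p%4≡1 d ⟩
        p ∸ 1
          ∎
        where
        ∑-graph-proj₁ : ∀ f → ∑ (f ∘ proj₁) graph ≡ ∑ f F.elements
        ∑-graph-proj₁ f = trans (sym (∑-map f proj₁ graph)) (∑-↭ f proj₁-graph)

      ∑-count : ∑ count repsK ≡ (p ∸ 1) / 4
      ∑-count = begin
        -- Four times the count is p - 1, so the truncating division is exact here.
        ∑ count repsK                    ≡⟨ m*n/n≡m (∑ count repsK) 4 ⟨
        ∑ count repsK Nat.* 4 / 4        ≡⟨ cong (_/ 4) (trans (ℕ.*-comm (∑ count repsK) 4) (trans 4*∑-count ∑-count-nonZeros)) ⟩
        (p ∸ 1) / 4                      ∎

  isRelativeDF : IsRelativeDF p ((p ∸ 1) / 4) blocks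
  isRelativeDF =
    All.map⁺ (All.tabulate λ {s} s∈ → lookup-injective (block s) (block-unique (repsK-nonZero s∈))) ,
    λ (d , l) →
      (λ l≡0 → trans (Count.multiplicity-blocks d l)
        (∑-zero repsK λ s∈ → Count.count-zero d l l≡0 (repsK-nonZero s∈))) ,
      (λ l≢0 → trans (Count.multiplicity-blocks d l) (Count.∑-count d l l≢0))

theorem3p11 : (p q : ℕ) → IsPrimePower p → IsPrimePower q → p % 4 ≡ 1 → q % 4 ≡ 1 → p ≤ q →
    (F : FiniteField p) (K : FiniteField q) → ExistsRelDF F K p ((p ∸ 1) / 4)
theorem3p11 p q _ _ p%4≡1 q%4≡1 p≤q F K = blocks , isRelativeDF
  where open Construction p%4≡1 q%4≡1 p≤q F K
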